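{- For every $x\in\mathbf{Q}_{>0}$ one has $$\mathrm{num}(x)=\mathsf{F}\left(\frac{\mathsf{F}(x)}{\mathsf{F}(1/x)}\right),$$ where $\mathsf F$ is the codenominator function and $\mathrm{num}$ is the numerator function.
   Context: The numerator function $\mathrm{num}:\mathbf{Q}_{>0}\to\mathbf{Z}_{>0}$ sends $x=p/q$ (with $p,q$ positive integers, $\gcd(p,q)=1$) to $p$. The codenominator $\mathsf{F}:\mathbf{Q}_{>0}\to\mathbf{Z}_{>0}$ is the unique function with $\mathsf{F}(1)=1$ satisfying, for all $x\in\mathbf{Q}_{>0}$, $\mathsf{F}(1+1/x)=\mathsf{F}(x)$ and $\mathsf{F}\left(\frac{1}{1+x}\right)=\mathsf{F}(x)+\mathsf{F}(1/x)$. -}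

module Defs where

open import Data.Integer.Base as ℤ using (+_; +0; +[1+_]; -[1+_])
open import Data.Integer.Properties using (+-injective)
open import Data.Irrelevant using ([_])
open import Data.Nat.Base as ℕ using (ℕ; zero; suc; z≤n; s≤s)
open import Data.Nat.Properties
open import Data.Nat.Tactic.RingSolver using (solve-∀)
open import Data.Product using (∃!; _,_)
open import Data.Rational.Base as ℚ using (ℚ; mkℚ; 1ℚ; ↥_; ↧ₙ_; toℚᵘ)
open import Data.Rational.Properties
  using (pos⇒nonZero; 1/pos⇒pos; pos+pos⇒pos; normalize-pos; normalize-coprime;
         toℚᵘ-homo-+; toℚᵘ-injective; toℚᵘ-fromℚᵘ)
open import Data.Rational.Unnormalised.Base as ℚᵘ using (mkℚᵘ; *≡*)
import Data.Rational.Unnormalised.Properties as ℚᵘ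
open import Data.Refinement using (Refinement-syntax; _,_; value; value-injective)
open import Relation.Binary.Definitions using (tri<; tri≈; tri>)
open import Relation.Binary.PropositionalEquality
open import Relation.Nullary.Negation using (contradiction)

infixl 6 _+ℕ_ _+ℚ_
infixl 7 _/⁺_
infix  8 _⁻¹

ℕ⁺ : Set
ℕ⁺ = [ n ∈ ℕ ∣ ℕ.NonZero n ]

ℚ⁺ : Set
ℚ⁺ = [ x ∈ ℚ ∣ ℚ.Positive x ]

1ℕ⁺ : ℕ⁺
1ℕ⁺ = 1 , [ _ ]

_+ℕ_ : ℕ⁺ → ℕ⁺ → ℕ⁺
(m , [ m≢0 ]) +ℕ (n , _) = m ℕ.+ n , [ m+n≢0 m {{m≢0}} ]
  where
  m+n≢0 : ∀ m {n} .{{_ : ℕ.NonZero m}} → ℕ.NonZero (m ℕ.+ n)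
  m+n≢0 (suc _) = _

1ℚ⁺ : ℚ⁺
1ℚ⁺ = 1ℚ , [ _ ]

_+ℚ_ : ℚ⁺ → ℚ⁺ → ℚ⁺
(x , [ x>0 ]) +ℚ (y , [ y>0 ]) = x ℚ.+ y , [ pos+pos⇒pos x {{x>0}} y {{y>0}} ]

_⁻¹ : ℚ⁺ → ℚ⁺
(x , [ x>0 ]) ⁻¹ =
  (ℚ.1/ x) {{pos⇒nonZero x {{x>0}}}} , [ 1/pos⇒pos x {{x>0}} ]

_/⁺_ : ℕ⁺ → ℕ⁺ → ℚ⁺
(m , [ m≢0 ]) /⁺ (n , [ n≢0 ]) =
  ((+ m) ℚ./ n) {{n≢0}} , [ normalize-pos m n {{n≢0}} {{m≢0}} ]

-- Elements of ℚ are stored in lowest terms.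
num : ℚ⁺ → ℕ⁺
num (x@record{} , [ x>0 ]) = ℤ.∣ ↥ x ∣ , [ pos⇒nonZero x {{x>0}} ]

-- These laws determine F, and such an F exists: see codenominator-∃! below.
record IsCodenominator (F : ℚ⁺ → ℕ⁺) : Set where
  field
    F[1]       : F 1ℚ⁺ ≡ 1ℕ⁺
    F[1+1/x]   : ∀ x → F (1ℚ⁺ +ℚ x ⁻¹) ≡ F x
    F[1/[1+x]] : ∀ x → F ((1ℚ⁺ +ℚ x) ⁻¹) ≡ F x +ℕ F (x ⁻¹)

private

  -- f k p q is the value at p/q, for fuel k ≥ p + q.
  f : ℕ → ℕ → ℕ → ℕ
  f zero    p q = 1
  f (suc k) p q with <-cmp p q
  ... | tri< _ _ _ = f k (q ℕ.∸ p) p ℕ.+ f k p (q ℕ.∸ p)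
  ... | tri≈ _ _ _ = 1
  ... | tri> _ _ _ = f k q (p ℕ.∸ q)

  f≢0 : ∀ k p q → ℕ.NonZero (f k p q)
  f≢0 zero    p q = _
  f≢0 (suc k) p q with <-cmp p q
  ... | tri< _ _ _ =
    ℕ.>-nonZero (≤-trans (ℕ.>-nonZero⁻¹ _ {{f≢0 k (q ℕ.∸ p) p}}) (m≤m+n _ _))
  ... | tri≈ _ _ _ = _
  ... | tri> _ _ _ = f≢0 k q (p ℕ.∸ q)

  f-< : ∀ k p q → p ℕ.< q →
        f (suc k) p q ≡ f k (q ℕ.∸ p) p ℕ.+ f k p (q ℕ.∸ p)
  f-< k p q p<q with <-cmp p q
  ... | tri< _ _ _   = refl
  ... | tri≈ p≮q _ _ = contradiction p<q p≮q
  ... | tri> p≮q _ _ = contradiction p<q p≮q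

  f-> : ∀ k p q → q ℕ.< p → f (suc k) p q ≡ f k q (p ℕ.∸ q)
  f-> k p q q<p with <-cmp p q
  ... | tri< _ _ q≮p = contradiction q<p q≮p
  ... | tri≈ _ _ q≮p = contradiction q<p q≮p
  ... | tri> _ _ _   = refl

  f-≡ : ∀ k p → f (suc k) p p ≡ 1
  f-≡ k p with <-cmp p p
  ... | tri< _ p≢p _ = contradiction refl p≢p
  ... | tri≈ _ _ _   = refl
  ... | tri> _ p≢p _ = contradiction refl p≢p

  f-scale : ∀ k c p q .{{_ : ℕ.NonZero c}} → f k (c ℕ.* p) (c ℕ.* q) ≡ f k p q
  f-scale zero    c p q = refl
  f-scale (suc k) c p q with <-cmp p q
  ... | tri< p<q _ _
    rewrite f-< k (c ℕ.* p) (c ℕ.* q) (*-monoʳ-< c p<q)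
          | sym (*-distribˡ-∸ c q p)
    = cong₂ ℕ._+_ (f-scale k c (q ℕ.∸ p) p) (f-scale k c p (q ℕ.∸ p))
  ... | tri≈ _ refl _ = f-≡ k (c ℕ.* p)
  ... | tri> _ _ q<p
    rewrite f-> k (c ℕ.* p) (c ℕ.* q) (*-monoʳ-< c q<p)
          | sym (*-distribˡ-∸ c p q)
    = f-scale k c q (p ℕ.∸ q)

  drop-fuel : ∀ {k p q} → 0 ℕ.< p → p ℕ.< q → p ℕ.+ q ℕ.≤ suc k →
              p ℕ.+ (q ℕ.∸ p) ℕ.≤ k
  drop-fuel {k} {p} {q} 0<p p<q h rewrite m+[n∸m]≡n (<⇒≤ p<q) =
    ℕ.s≤s⁻¹ (≤-trans (+-monoˡ-≤ q 0<p) h)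

  f-fuel : ∀ k l p q → 0 ℕ.< p → 0 ℕ.< q → p ℕ.+ q ℕ.≤ k → p ℕ.+ q ℕ.≤ l →
           f k p q ≡ f l p q
  f-fuel zero    l       (suc p) q 0<p 0<q () h′
  f-fuel (suc k) zero    (suc p) q 0<p 0<q h ()
  f-fuel (suc k) (suc l) p q 0<p 0<q h h′ with <-cmp p q
  ... | tri≈ _ _ _ = refl
  ... | tri< p<q _ _ =
    cong₂ ℕ._+_
      (f-fuel k l (q ℕ.∸ p) p (m<n⇒0<n∸m p<q) 0<p (swap d) (swap d′))
      (f-fuel k l p (q ℕ.∸ p) 0<p (m<n⇒0<n∸m p<q) d d′)
    where
    d = drop-fuel 0<p p<q h
    d′ = drop-fuel 0<p p<q h′
    swap : ∀ {j} → p ℕ.+ (q ℕ.∸ p) ℕ.≤ j → (q ℕ.∸ p) ℕ.+ p ℕ.≤ j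
    swap {j} = subst (ℕ._≤ j) (+-comm p (q ℕ.∸ p))
  ... | tri> _ _ q<p =
    f-fuel k l q (p ℕ.∸ q) 0<q (m<n⇒0<n∸m q<p)
      (drop-fuel 0<q q<p (subst (ℕ._≤ suc k) (+-comm p q) h))
      (drop-fuel 0<q q<p (subst (ℕ._≤ suc l) (+-comm p q) h′))

  g : ℕ → ℕ → ℕ
  g p q = f (p ℕ.+ q) p q

  g-scale : ∀ c p q → g (suc c ℕ.* suc p) (suc c ℕ.* suc q) ≡ g (suc p) (suc q)
  g-scale c p q = trans (f-scale K (suc c) (suc p) (suc q))
    (f-fuel K _ (suc p) (suc q) (s≤s z≤n) (s≤s z≤n)
      (+-mono-≤ (m≤n*m (suc p) (suc c)) (m≤n*m (suc q) (suc c))) ≤-refl)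
    where K = suc c ℕ.* suc p ℕ.+ suc c ℕ.* suc q

  g-cross : ∀ p q r s → suc p ℕ.* suc s ≡ suc r ℕ.* suc q →
            g (suc p) (suc q) ≡ g (suc r) (suc s)
  g-cross p q r s eq = begin
    g (suc p) (suc q)                      ≡⟨ g-scale s p q ⟨
    g (suc s ℕ.* suc p) (suc s ℕ.* suc q)  ≡⟨ cong₂ g
      (trans (*-comm (suc s) (suc p)) (trans eq (*-comm (suc r) (suc q))))
      (*-comm (suc s) (suc q)) ⟩
    g (suc q ℕ.* suc r) (suc q ℕ.* suc s)  ≡⟨ g-scale q r s ⟩
    g (suc r) (suc s)                      ∎
    where open ≡-Reasoning

  g-> : ∀ p q → g (suc p ℕ.+ suc q) (suc p) ≡ g (suc p) (suc q)
  g-> p q = begin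
    g (P ℕ.+ Q) P           ≡⟨ f-> _ (P ℕ.+ Q) P (m<m+n P (s≤s z≤n)) ⟩
    f K P (P ℕ.+ Q ℕ.∸ P)   ≡⟨ cong (f K P) (m+n∸m≡n P Q) ⟩
    f K P Q                 ≡⟨ f-fuel K _ P Q (s≤s z≤n) (s≤s z≤n)
                                 (≤-trans (m≤m+n (P ℕ.+ Q) p)
                                    (≤-reflexive (lemma p q))) ≤-refl ⟩
    g P Q                   ∎
    where
    open ≡-Reasoning
    P = suc p
    Q = suc q
    K = p ℕ.+ Q ℕ.+ P
    lemma : ∀ p q → suc p ℕ.+ suc q ℕ.+ p ≡ p ℕ.+ suc q ℕ.+ suc p
    lemma = solve-∀

  g-< : ∀ p q → g (suc q) (suc p ℕ.+ suc q) ≡ g (suc p) (suc q) ℕ.+ g (suc q) (suc p)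
  g-< p q = begin
    g Q (P ℕ.+ Q)  ≡⟨ f-< K Q (P ℕ.+ Q) (m<n+m Q (s≤s z≤n)) ⟩
    f K (P ℕ.+ Q ℕ.∸ Q) Q ℕ.+ f K Q (P ℕ.+ Q ℕ.∸ Q)
                   ≡⟨ cong (λ t → f K t Q ℕ.+ f K Q t) (m+n∸n≡m P Q) ⟩
    f K P Q ℕ.+ f K Q P
                   ≡⟨ cong₂ ℕ._+_
                        (f-fuel K _ P Q (s≤s z≤n) (s≤s z≤n) (m≤n+m _ q) ≤-refl)
                        (f-fuel K _ Q P (s≤s z≤n) (s≤s z≤n)
                          (subst (ℕ._≤ K) (+-comm P Q) (m≤n+m _ q)) ≤-refl) ⟩
    g P Q ℕ.+ g Q P  ∎
    where
    open ≡-Reasoning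
    P = suc p
    Q = suc q
    K = q ℕ.+ (P ℕ.+ Q)

  G : ℚ⁺ → ℕ⁺
  G (x , _) = g ℤ.∣ ↥ x ∣ (↧ₙ x) , [ f≢0 (ℤ.∣ ↥ x ∣ ℕ.+ ↧ₙ x) ℤ.∣ ↥ x ∣ (↧ₙ x) ]

  [1+_] : ℕ → ℕ⁺
  [1+ n ] = suc n , [ _ ]

  frac : ℕ → ℕ → ℚ⁺
  frac p q = [1+ p ] /⁺ [1+ q ]

  data AsFrac : ℚ⁺ → Set where
    asFrac : ∀ p q → AsFrac (frac p q)

  toFrac : ∀ x → AsFrac x
  toFrac (mkℚ +0 _ _       , [ () ])
  toFrac (mkℚ -[1+ _ ] _ _ , [ () ])
  toFrac (mkℚ +[1+ n ] d c , [ _ ]) =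
    subst AsFrac (value-injective (normalize-coprime c)) (asFrac n d)

  frac-≃ : ∀ x p q → toℚᵘ (value x) ℚᵘ.≃ mkℚᵘ +[1+ p ] q → x ≡ frac p q
  frac-≃ x p q eq = value-injective
    (toℚᵘ-injective (ℚᵘ.≃-trans eq (ℚᵘ.≃-sym (toℚᵘ-fromℚᵘ (mkℚᵘ +[1+ p ] q)))))

  frac-inv : ∀ p q → frac p q ⁻¹ ≡ frac q p
  frac-inv p q = inv (frac p q) (toℚᵘ-fromℚᵘ (mkℚᵘ +[1+ p ] q))
    where
    inv : ∀ x → toℚᵘ (value x) ℚᵘ.≃ mkℚᵘ +[1+ p ] q → x ⁻¹ ≡ frac q p
    inv (mkℚ +0 _ _       , [ () ])
    inv (mkℚ -[1+ _ ] _ _ , [ () ])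
    inv x@(mkℚ +[1+ n ] d c , [ _ ]) (*≡* eq) = frac-≃ (x ⁻¹) q p
      (*≡* (cong +_ (trans (*-comm (suc d) (suc p)) (trans (sym (+-injective eq))
        (*-comm (suc n) (suc q))))))

  frac-1+ : ∀ p q → 1ℚ⁺ +ℚ frac p q ≡ frac (p ℕ.+ suc q) q
  frac-1+ p q = frac-≃ (1ℚ⁺ +ℚ frac p q) (p ℕ.+ suc q) q
    (ℚᵘ.≃-trans (toℚᵘ-homo-+ 1ℚ (value (frac p q)))
      (ℚᵘ.≃-trans (ℚᵘ.+-congʳ (toℚᵘ 1ℚ) (toℚᵘ-fromℚᵘ (mkℚᵘ +[1+ p ] q)))
        (*≡* (cong +_ (lemma p q)))))
    where
    lemma : ∀ p q → (suc (q ℕ.+ 0) ℕ.+ suc (p ℕ.* 1)) ℕ.* suc q ≡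
                    suc (p ℕ.+ suc q) ℕ.* suc (q ℕ.+ 0)
    lemma = solve-∀

  frac-self : ∀ p → frac p p ≡ 1ℚ⁺
  frac-self p = sym (frac-≃ 1ℚ⁺ p p (*≡* (cong +_ (*-comm 1 (suc p)))))

  G-frac : ∀ p q → value (G (frac p q)) ≡ g (suc p) (suc q)
  G-frac p q = go (frac p q) (toℚᵘ-fromℚᵘ (mkℚᵘ +[1+ p ] q))
    where
    go : ∀ x → toℚᵘ (value x) ℚᵘ.≃ mkℚᵘ +[1+ p ] q → value (G x) ≡ g (suc p) (suc q)
    go (mkℚ +0 _ _       , [ () ])
    go (mkℚ -[1+ _ ] _ _ , [ () ])
    go (mkℚ +[1+ n ] d c , [ _ ]) (*≡* eq) = g-cross n d p q (+-injective eq)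

  G-isCodenominator : IsCodenominator G
  G-isCodenominator = record
    { F[1]       = refl
    ; F[1+1/x]   = λ x → value-injective (eq₁ (toFrac x))
    ; F[1/[1+x]] = λ x → value-injective (eq₂ (toFrac x))
    }
    where
    eq₁ : ∀ {x} → AsFrac x → value (G (1ℚ⁺ +ℚ x ⁻¹)) ≡ value (G x)
    eq₁ (asFrac p q) = begin
      value (G (1ℚ⁺ +ℚ frac p q ⁻¹))    ≡⟨ cong (λ y → value (G (1ℚ⁺ +ℚ y))) (frac-inv p q) ⟩
      value (G (1ℚ⁺ +ℚ frac q p))       ≡⟨ cong (λ y → value (G y)) (frac-1+ q p) ⟩
      value (G (frac (q ℕ.+ suc p) p))  ≡⟨ G-frac (q ℕ.+ suc p) p ⟩
      g (suc q ℕ.+ suc p) (suc p)       ≡⟨ cong (λ t → g t (suc p)) (+-comm (suc q) (suc p)) ⟩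
      g (suc p ℕ.+ suc q) (suc p)       ≡⟨ g-> p q ⟩
      g (suc p) (suc q)                 ≡⟨ G-frac p q ⟨
      value (G (frac p q))              ∎
      where open ≡-Reasoning
    eq₂ : ∀ {x} → AsFrac x → value (G ((1ℚ⁺ +ℚ x) ⁻¹)) ≡ value (G x +ℕ G (x ⁻¹))
    eq₂ (asFrac p q) = begin
      value (G ((1ℚ⁺ +ℚ frac p q) ⁻¹))       ≡⟨ cong (λ y → value (G (y ⁻¹))) (frac-1+ p q) ⟩
      value (G (frac (p ℕ.+ suc q) q ⁻¹))    ≡⟨ cong (λ y → value (G y)) (frac-inv (p ℕ.+ suc q) q) ⟩
      value (G (frac q (p ℕ.+ suc q)))       ≡⟨ G-frac q (p ℕ.+ suc q) ⟩
      g (suc q) (suc p ℕ.+ suc q)            ≡⟨ g-< p q ⟩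
      g (suc p) (suc q) ℕ.+ g (suc q) (suc p)
        ≡⟨ cong₂ ℕ._+_ (G-frac p q) (G-frac q p) ⟨
      value (G (frac p q)) ℕ.+ value (G (frac q p))
        ≡⟨ cong (λ y → value (G (frac p q)) ℕ.+ value (G y)) (frac-inv p q) ⟨
      value (G (frac p q) +ℕ G (frac p q ⁻¹))  ∎
      where open ≡-Reasoning

  module _ {F H} (isF : IsCodenominator F) (isH : IsCodenominator H) where
    private
      module F = IsCodenominator isF
      module H = IsCodenominator isH

    agree : ∀ k p q → p ℕ.+ q ℕ.< k → F (frac p q) ≡ H (frac p q)
    agree (suc k) p q (s≤s h) with ℕ.compare p q
    ... | ℕ.equal p =
      subst (λ x → F x ≡ H x) (sym (frac-self p)) (trans F.F[1] (sym H.F[1]))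
    ... | ℕ.less p d
      = subst (λ x → F x ≡ H x) (sym eq) (trans (F.F[1/[1+x]] (frac d p))
          (trans (cong₂ _+ℕ_ (agree k d p (subst (ℕ._< k) (+-comm p d) h′))
                   (trans (cong F (frac-inv d p))
                     (trans (agree k p d h′) (cong H (sym (frac-inv d p))))))
            (sym (H.F[1/[1+x]] (frac d p)))))
      where
      h′ : p ℕ.+ d ℕ.< k
      h′ = ≤-trans (m≤n+m (suc (p ℕ.+ d)) p) h
      eq : frac p (suc (p ℕ.+ d)) ≡ (1ℚ⁺ +ℚ frac d p) ⁻¹
      eq = sym (trans (cong _⁻¹ (frac-1+ d p))
        (trans (frac-inv (d ℕ.+ suc p) p)
          (cong (frac p) (trans (+-suc d p) (cong suc (+-comm d p))))))
    ... | ℕ.greater q d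
      = subst (λ x → F x ≡ H x) (sym eq) (trans (F.F[1+1/x] (frac q d))
          (trans (agree k q d (≤-trans (m≤m+n (suc (q ℕ.+ d)) q) h))
            (sym (H.F[1+1/x] (frac q d)))))
      where
      eq : frac (suc (q ℕ.+ d)) q ≡ 1ℚ⁺ +ℚ frac q d ⁻¹
      eq = sym (trans (cong (1ℚ⁺ +ℚ_) (frac-inv q d))
        (trans (frac-1+ d q)
          (cong (λ t → frac t q) (trans (+-suc d q) (cong suc (+-comm d q))))))

    agree-everywhere : F ≗ H
    agree-everywhere x with toFrac x
    ... | asFrac p q = agree (suc (p ℕ.+ q)) p q ≤-refl

codenominator-∃! : ∃! _≗_ IsCodenominator
codenominator-∃! =
  G , G-isCodenominator , agree-everywhere G-isCodenominator

{-# OPTIONS --safe #-}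
module Submission where

open import Defs
open import Data.Integer.Base using (+_; +0; +[1+_]; -[1+_])
open import Data.Integer.Properties using (+-injective)
open import Data.Irrelevant using ([_])
open import Data.Nat.Base as ℕ using (ℕ; suc; s≤s)
open import Data.Nat.Coprimality as Coprimality using (Coprime; coprime-+)
open import Data.Nat.Properties
open import Data.Nat.Tactic.RingSolver using (solve-∀)
open import Data.Product using (_×_; _,_; proj₁)
open import Data.Rational.Base using (mkℚ; 1ℚ; toℚᵘ)
open import Data.Rational.Properties
  using (normalize-coprime; toℚᵘ-homo-+; toℚᵘ-injective; toℚᵘ-fromℚᵘ)
open import Data.Rational.Unnormalised.Base as ℚᵘ using (mkℚᵘ; *≡*)
import Data.Rational.Unnormalised.Properties as ℚᵘ
open import Data.Refinement using (_,_; value; value-injective)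
open import Relation.Binary.PropositionalEquality hiding (J)

-- Put J x = F x / F (1/x). The laws of F give J (1/x) = 1/J x and
-- J (1 + x) = 1/(1 + J x), hence
--   F (J (1 + x))     = F (J x) + F (J (1/x))  and
--   F (J (1/(1 + x))) = F (1 + J x) = F (J (1/x)).
-- The numerator satisfies the same recursion, and every positive rational is
-- reached from 1 by x ↦ 1 + x and x ↦ 1/x.

[1+_] : ℕ → ℕ⁺
[1+ n ] = suc n , [ _ ]

-- Positivity proofs are irrelevant and `toℚᵘ` is injective, so identities between positive
-- fractions reduce to cross-multiplication in ℕ.
/⁺-unique : ∀ x p q → toℚᵘ (value x) ℚᵘ.≃ mkℚᵘ +[1+ p ] q →
            x ≡ [1+ p ] /⁺ [1+ q ]
/⁺-unique x p q eq = value-injective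
  (toℚᵘ-injective (ℚᵘ.≃-trans eq (ℚᵘ.≃-sym (toℚᵘ-fromℚᵘ (mkℚᵘ +[1+ p ] q)))))

/⁺-⁻¹ : ∀ m n → (m /⁺ n) ⁻¹ ≡ n /⁺ m
/⁺-⁻¹ (suc p , _) (suc q , _) =
  -- `⁻¹` computes only on a `mkℚ` form, which the normalisation in `/⁺` hides. Hence the fraction
  -- is generalised to any `x` equivalent to (p + 1)/(q + 1).
  go ([1+ p ] /⁺ [1+ q ]) (toℚᵘ-fromℚᵘ (mkℚᵘ +[1+ p ] q))
  where
  go : ∀ x → toℚᵘ (value x) ℚᵘ.≃ mkℚᵘ +[1+ p ] q →
       x ⁻¹ ≡ [1+ q ] /⁺ [1+ p ]
  go (mkℚ +0 _ _       , [ () ])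
  go (mkℚ -[1+ _ ] _ _ , [ () ])
  go x@(mkℚ +[1+ n ] d _ , _) (*≡* eq) = /⁺-unique (x ⁻¹) q p
    (*≡* (cong +_ (trans (*-comm (suc d) (suc p)) (trans (sym (+-injective eq))
      (*-comm (suc n) (suc q))))))

1+/⁺ : ∀ m n → 1ℚ⁺ +ℚ m /⁺ n ≡ (m +ℕ n) /⁺ n
1+/⁺ (suc p , _) (suc q , _) =
  /⁺-unique (1ℚ⁺ +ℚ [1+ p ] /⁺ [1+ q ]) (p ℕ.+ suc q) q
    (ℚᵘ.≃-trans (toℚᵘ-homo-+ 1ℚ (value ([1+ p ] /⁺ [1+ q ])))
      (ℚᵘ.≃-trans (ℚᵘ.+-congʳ (toℚᵘ 1ℚ) (toℚᵘ-fromℚᵘ (mkℚᵘ +[1+ p ] q)))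
        (*≡* (cong +_ (cross p q)))))
  where
  cross : ∀ p q → (suc (q ℕ.+ 0) ℕ.+ suc (p ℕ.* 1)) ℕ.* suc q ≡
                  suc (p ℕ.+ suc q) ℕ.* suc (q ℕ.+ 0)
  cross = solve-∀

/⁺-self : ∀ m → m /⁺ m ≡ 1ℚ⁺
/⁺-self (suc p , _) = sym (/⁺-unique 1ℚ⁺ p p (*≡* (cong +_ (*-comm 1 (suc p)))))

-- The coprimality argument is irrelevant because the field of `mkℚ` that supplies it is.
data LowestTerms : ℚ⁺ → Set where
  lowest : ∀ m n → .(Coprime (value m) (value n)) → LowestTerms (m /⁺ n)

lowestTerms : ∀ x → LowestTerms x
lowestTerms (mkℚ +0 _ _       , [ () ])
lowestTerms (mkℚ -[1+ _ ] _ _ , [ () ])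
lowestTerms (mkℚ +[1+ n ] d c , _) =
  subst LowestTerms (value-injective (normalize-coprime c))
    (lowest [1+ n ] [1+ d ] c)

-- By coprimality, normalisation has no common factor to cancel.
num-/⁺ : ∀ m n → .(Coprime (value m) (value n)) → num (m /⁺ n) ≡ m
num-/⁺ (suc p , _) (suc q , _) c =
  cong num (value-injective {v = [1+ p ] /⁺ [1+ q ]}
    {w = mkℚ +[1+ p ] q c , [ _ ]} (normalize-coprime c))

⁻¹-involutive : ∀ x → x ⁻¹ ⁻¹ ≡ x
⁻¹-involutive x with lowest m n _ ← lowestTerms x =
  trans (cong _⁻¹ (/⁺-⁻¹ m n)) (/⁺-⁻¹ n m)

coprime-+ℕ : ∀ m n → Coprime (value m) (value n) → Coprime (value (m +ℕ n)) (value n)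
coprime-+ℕ m n c =
  subst (λ k → Coprime k (value n)) (+-comm (value n) (value m)) (coprime-+ c)

-- If `x` is m/n in lowest terms, then (m + n)/n is in lowest terms too, and the summand n is the
-- numerator of the inverse.
num-1+ : ∀ x → num (1ℚ⁺ +ℚ x) ≡ num x +ℕ num (x ⁻¹)
num-1+ x with lowest m n c ← lowestTerms x = begin
  num (1ℚ⁺ +ℚ m /⁺ n)                ≡⟨ cong num (1+/⁺ m n) ⟩
  num ((m +ℕ n) /⁺ n)                ≡⟨ num-/⁺ (m +ℕ n) n (coprime-+ℕ m n c) ⟩
  m +ℕ n                             ≡⟨ cong₂ _+ℕ_ (num-/⁺ m n c) (num-/⁺ n m (Coprimality.sym c)) ⟨
  num (m /⁺ n) +ℕ num (n /⁺ m)       ≡⟨ cong (λ y → num (m /⁺ n) +ℕ num y) (/⁺-⁻¹ m n) ⟨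
  num (m /⁺ n) +ℕ num ((m /⁺ n) ⁻¹)  ∎
  where open ≡-Reasoning

-- Adding 1 to a reduced fraction keeps its denominator, which inversion turns into the numerator.
num-1+-⁻¹ : ∀ x → num ((1ℚ⁺ +ℚ x) ⁻¹) ≡ num (x ⁻¹)
num-1+-⁻¹ x with lowest m n c ← lowestTerms x = begin
  num ((1ℚ⁺ +ℚ m /⁺ n) ⁻¹)  ≡⟨ cong (λ y → num (y ⁻¹)) (1+/⁺ m n) ⟩
  num (((m +ℕ n) /⁺ n) ⁻¹)  ≡⟨ cong num (/⁺-⁻¹ (m +ℕ n) n) ⟩
  num (n /⁺ (m +ℕ n))       ≡⟨ num-/⁺ n (m +ℕ n) (Coprimality.sym (coprime-+ℕ m n c)) ⟩
  n                         ≡⟨ num-/⁺ n m (Coprimality.sym c) ⟨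
  num (n /⁺ m)              ≡⟨ cong num (/⁺-⁻¹ m n) ⟨
  num ((m /⁺ n) ⁻¹)         ∎
  where open ≡-Reasoning

module _ (P : ℚ⁺ → Set)
         (P-1 : P 1ℚ⁺)
         (P-1+ : ∀ x → P x → P (1ℚ⁺ +ℚ x))
         (P-⁻¹ : ∀ x → P x → P (x ⁻¹)) where

  -- The subtractive Euclidean algorithm on the pair (p + 1, q + 1). The fuel `k` strictly bounds p
  -- + q, which falls with every subtraction.
  euclid : ∀ k p q → p ℕ.+ q ℕ.< k → P ([1+ p ] /⁺ [1+ q ])
  euclid-> : ∀ k q d → q ℕ.+ d ℕ.< k → P ([1+ suc (q ℕ.+ d) ] /⁺ [1+ q ])

  euclid (suc k) p q (s≤s h) with ℕ.compare p q
  ... | ℕ.equal p     = subst P (sym (/⁺-self [1+ p ])) P-1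
  -- Numerator below denominator: inverting first allows the same subtraction.
  ... | ℕ.less p d    = subst P (/⁺-⁻¹ [1+ suc (p ℕ.+ d) ] [1+ p ])
    (P-⁻¹ ([1+ suc (p ℕ.+ d) ] /⁺ [1+ p ])
      (euclid-> k p d (≤-trans (m≤n+m (suc (p ℕ.+ d)) p) h)))
  ... | ℕ.greater q d = euclid-> k q d (≤-trans (m≤m+n (suc (q ℕ.+ d)) q) h)

  -- Subtracting the denominator q + 1 from the numerator q + d + 2 leaves d + 1.
  euclid-> k q d h =
    subst P eq (P-1+ ([1+ d ] /⁺ [1+ q ]) (euclid k d q (subst (ℕ._< k) (+-comm q d) h)))
    where
    eq : 1ℚ⁺ +ℚ [1+ d ] /⁺ [1+ q ] ≡ [1+ suc (q ℕ.+ d) ] /⁺ [1+ q ]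
    eq = trans (1+/⁺ [1+ d ] [1+ q ])
      (cong (_/⁺ [1+ q ])
        (value-injective (cong suc (trans (+-suc d q) (cong suc (+-comm d q))))))

  ℚ⁺-induction : ∀ x → P x
  ℚ⁺-induction x with lowestTerms x
  ... | lowest (suc p , _) (suc q , _) _ = euclid (suc (p ℕ.+ q)) p q ≤-refl

module _ {F : ℚ⁺ → ℕ⁺} (isF : IsCodenominator F) where
  open IsCodenominator isF
  open ≡-Reasoning

  J : ℚ⁺ → ℚ⁺
  J x = F x /⁺ F (x ⁻¹)

  J-1 : J 1ℚ⁺ ≡ 1ℚ⁺
  -- Both `1ℚ⁺ ⁻¹` and `1ℕ⁺ /⁺ 1ℕ⁺` compute to `1ℚ⁺`.
  J-1 = cong₂ _/⁺_ F[1] F[1]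

  J-⁻¹ : ∀ x → J (x ⁻¹) ≡ J x ⁻¹
  J-⁻¹ x = begin
    F (x ⁻¹) /⁺ F (x ⁻¹ ⁻¹)  ≡⟨ cong (λ y → F (x ⁻¹) /⁺ F y) (⁻¹-involutive x) ⟩
    F (x ⁻¹) /⁺ F x          ≡⟨ /⁺-⁻¹ (F x) (F (x ⁻¹)) ⟨
    J x ⁻¹                   ∎

  F-1+ : ∀ x → F (1ℚ⁺ +ℚ x) ≡ F (x ⁻¹)
  F-1+ x = trans (cong (λ y → F (1ℚ⁺ +ℚ y)) (sym (⁻¹-involutive x))) (F[1+1/x] (x ⁻¹))

  J-1+ : ∀ x → J (1ℚ⁺ +ℚ x) ≡ (1ℚ⁺ +ℚ J x) ⁻¹
  J-1+ x = begin
    J (1ℚ⁺ +ℚ x)                    ≡⟨ cong₂ _/⁺_ (F-1+ x) (F[1/[1+x]] x) ⟩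
    F (x ⁻¹) /⁺ (F x +ℕ F (x ⁻¹))   ≡⟨ /⁺-⁻¹ (F x +ℕ F (x ⁻¹)) (F (x ⁻¹)) ⟨
    ((F x +ℕ F (x ⁻¹)) /⁺ F (x ⁻¹)) ⁻¹
                                    ≡⟨ cong _⁻¹ (1+/⁺ (F x) (F (x ⁻¹))) ⟨
    (1ℚ⁺ +ℚ J x) ⁻¹                 ∎

  FJ-1+ : ∀ x → F (J (1ℚ⁺ +ℚ x)) ≡ F (J x) +ℕ F (J (x ⁻¹))
  FJ-1+ x = begin
    F (J (1ℚ⁺ +ℚ x))          ≡⟨ cong F (J-1+ x) ⟩
    F ((1ℚ⁺ +ℚ J x) ⁻¹)       ≡⟨ F[1/[1+x]] (J x) ⟩
    F (J x) +ℕ F (J x ⁻¹)     ≡⟨ cong (λ y → F (J x) +ℕ F y) (J-⁻¹ x) ⟨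
    F (J x) +ℕ F (J (x ⁻¹))   ∎

  -- Two inversions cancel, one from `J-⁻¹` and one from `J-1+`, which leaves 1 + `J x` for the
  -- first law.
  FJ-1+-⁻¹ : ∀ x → F (J ((1ℚ⁺ +ℚ x) ⁻¹)) ≡ F (J (x ⁻¹))
  FJ-1+-⁻¹ x = begin
    F (J ((1ℚ⁺ +ℚ x) ⁻¹))    ≡⟨ cong F (J-⁻¹ (1ℚ⁺ +ℚ x)) ⟩
    F (J (1ℚ⁺ +ℚ x) ⁻¹)      ≡⟨ cong (λ y → F (y ⁻¹)) (J-1+ x) ⟩
    F ((1ℚ⁺ +ℚ J x) ⁻¹ ⁻¹)   ≡⟨ cong F (⁻¹-involutive (1ℚ⁺ +ℚ J x)) ⟩
    F (1ℚ⁺ +ℚ J x)           ≡⟨ F-1+ (J x) ⟩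
    F (J x ⁻¹)               ≡⟨ cong F (J-⁻¹ x) ⟨
    F (J (x ⁻¹))             ∎

  -- The claim is carried for `x` and `x ⁻¹` together: the step to 1 + x adds the values at both,
  -- and the inversion step swaps them.
  num≡FJ : ∀ x → num x ≡ F (J x) × num (x ⁻¹) ≡ F (J (x ⁻¹))
  num≡FJ = ℚ⁺-induction (λ x → num x ≡ F (J x) × num (x ⁻¹) ≡ F (J (x ⁻¹)))
    -- One proof serves twice, since `1ℚ⁺ ⁻¹` is `1ℚ⁺` by computation.
    (base , base)
    (λ x (p , q) →
      trans (num-1+ x) (trans (cong₂ _+ℕ_ p q) (sym (FJ-1+ x))) ,
      trans (num-1+-⁻¹ x) (trans q (sym (FJ-1+-⁻¹ x))))
    (λ x (p , q) → q , subst (λ y → num y ≡ F (J y)) (sym (⁻¹-involutive x)) p)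
    where
    base : num 1ℚ⁺ ≡ F (J 1ℚ⁺)
    base = sym (trans (cong F J-1) F[1])

theorem1 : ∀ (F : ℚ⁺ → ℕ⁺) → IsCodenominator F →
    ∀ (x : ℚ⁺) → num x ≡ F (F x /⁺ F (x ⁻¹))
theorem1 F isF x = proj₁ (num≡FJ isF x)
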